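{- Let $n\ge 1$, let $A\subseteq\omega$, let $\varphi=\varphi^{(n)}$ be a Gödel numbering of $\mathcal P^{(n)}$, and let $\psi$ be a $\varphi$-standard numbering of $\mathcal S^{(n)}_A$. Then the following two conditions hold: (QGN I) The extended graph of the $(n+1)$-ary function $(i,\vec x)\mapsto\psi_i(\vec x)$ is the range of some function in $\mathcal R^{(1)}$. (QGN II) For every $k\in\mathcal R^{(2)}$ there exists $v\in\mathcal R^{(1)}$ such that for all $i\in\omega$ and all $r\in\mathcal S^{(n)}_A$: if $t\mapsto k(i,t)$ enumerates (i.e. has as its range) the extended graph of $r$, then $r=\psi_{v(i)}$.
   Context: $\omega$ is the set of natural numbers. For $n\ge 1$, $\mathcal P^{(n)}$ and $\mathcal R^{(n)}$ are the sets of partial computable, respectively total computable, functions from $\omega^n$ to $\omega$. $\langle\cdot,\cdot\rangle:\omega^2\to\omega$ is a computable bijection with $\langle x,y\rangle\ge x,y$, extended to tuples by $\langle x\rangle=x$, $\langle x_1,\dots,x_{n+1}\rangle=\langle x_1,\langle x_2,\dots,x_{n+1}\rangle\rangle$. For $A\subseteq\omega$, $\mathrm{Anf}^{(n)}_A$ is the set of partial functions from $\omega^n$ to $\omega$ whose domain is either empty or of the form $\{0,\dots,a-1\}^n$ with $a\in A$, and $\mathcal S^{(n)}_A=\mathcal R^{(n)}\cup\mathrm{Anf}^{(n)}_A$. The extended graph of a partial function $q$ from $\omega^n$ to $\omega$ is the set $\{\langle\langle\vec y\rangle,0\rangle:\vec y\in\omega^n\}\cup\{\langle\langle\vec x\rangle,q(\vec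 x)+1\rangle:\vec x\in\mathrm{dom}(q)\}$. A numbering of a set $X$ is a surjection $\omega\to X$, with value at $i$ written with subscript $i$. A Gödel numbering of $\mathcal P^{(n)}$ is a numbering whose universal function $(i,\vec x)\mapsto\varphi_i(\vec x)$ is partial computable and such that for every partial computable $g$ of arity $n+1$ there is $s\in\mathcal R^{(1)}$ with $\varphi_{s(i)}(\vec x)=g(i,\vec x)$ for all $i,\vec x$. A $\varphi$-standard numbering of a set $X\subseteq\mathcal P^{(n)}$ is a numbering $\psi$ of $X$ of the form $\psi_i=\varphi_{d(i)}$ for some $d\in\mathcal R^{(1)}$ such that, for all $i$, $\varphi_i\in X$ implies $\varphi_{d(i)}=\varphi_i$. -}

module Defs where

open import Data.Fin using (Fin)
open import Data.Nat using (ℕ; suc; _≤_; _<_)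
open import Data.Product using (∃-syntax; _×_; uncurry)
open import Data.Sum using (_⊎_)
open import Data.Vec using (Vec; []; _∷_; [_]; head; tail; lookup)
open import Data.Vec.Relation.Binary.Pointwise.Inductive using (Pointwise)
open import Data.Vec.Relation.Unary.All using (All)
open import Function.Bundles using (_⇔_)
open import Function.Definitions using (Bijective)
open import Level using (Level; 0ℓ; _⊔_) renaming (suc to lsuc)
open import Relation.Binary.PropositionalEquality using (_≡_; sym; trans)
open import Relation.Unary using (Pred; _∈_; _≐_; _∪_; Empty)

private
  variable
    ℓ : Level
    m n : ℕ

-- "Partial computable" is rendered by the μ-recursive functions.

data Code : ℕ → Set where
  zero : Code n
  suc  : Code 1
  proj : Fin n → Code n
  comp : Code m → Vec (Code n) m → Code n
  rec  : Code n → Code (suc (suc n)) → Code (suc n)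
  μ    : Code (suc n) → Code n

infix 4 _[_]⇓_

data _[_]⇓_ : Code n → Vec ℕ n → ℕ → Set where
  zero⇓ : {xs : Vec ℕ n} → zero [ xs ]⇓ 0
  suc⇓  : ∀ {x} → suc [ x ∷ [] ]⇓ suc x
  proj⇓ : {xs : Vec ℕ n} (i : Fin n) → proj i [ xs ]⇓ lookup xs i
  comp⇓ : {f : Code m} {gs : Vec (Code n) m} {xs : Vec ℕ n} {ys : Vec ℕ m} {z : ℕ} →
          Pointwise (λ g y → g [ xs ]⇓ y) gs ys → f [ ys ]⇓ z →
          comp f gs [ xs ]⇓ z
  rec⇓₀ : {f : Code n} {g : Code (suc (suc n))} {xs : Vec ℕ n} {y : ℕ} →
          f [ xs ]⇓ y → rec f g [ 0 ∷ xs ]⇓ y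
  rec⇓₊ : {f : Code n} {g : Code (suc (suc n))} {xs : Vec ℕ n} {k y z : ℕ} →
          rec f g [ k ∷ xs ]⇓ y → g [ k ∷ y ∷ xs ]⇓ z →
          rec f g [ suc k ∷ xs ]⇓ z
  -- The search requires f to converge, to a nonzero value, below the result.
  μ⇓    : {f : Code (suc n)} {xs : Vec ℕ n} {y : ℕ} →
          (∀ k → k < y → ∃[ w ] f [ k ∷ xs ]⇓ suc w) → f [ y ∷ xs ]⇓ 0 →
          μ f [ xs ]⇓ y

-- Partial functions are arbitrary single-valued relations: no decidability of
-- the domain and no computability is built in.

record PartFun (n : ℕ) : Set₁ where
  field
    Graph        : Vec ℕ n → ℕ → Set
    singleValued : ∀ {xs y z} → Graph xs y → Graph xs z → y ≡ z

open PartFun public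

infix 4 _≈_

_≈_ : PartFun n → PartFun n → Set
p ≈ q = ∀ xs y → Graph p xs y ⇔ Graph q xs y

Dom : PartFun n → Pred (Vec ℕ n) 0ℓ
Dom q xs = ∃[ y ] Graph q xs y

⌜_⌝ : (Vec ℕ n → ℕ) → PartFun n
⌜ f ⌝ = record
  { Graph        = λ xs y → f xs ≡ y
  ; singleValued = λ e e′ → trans (sym e) e′
  }

𝒫 : ∀ n → Pred (PartFun n) 0ℓ
𝒫 n q = ∃[ c ] (∀ xs y → c [ xs ]⇓ y ⇔ Graph q xs y)

𝓡 : ∀ n → Pred (Vec ℕ n → ℕ) 0ℓ
𝓡 n f = ⌜ f ⌝ ∈ 𝒫 n

Anf : ∀ n → Pred ℕ ℓ → Pred (PartFun n) ℓ
Anf n A q = Empty (Dom q) ⊎ ∃[ a ] (a ∈ A × Dom q ≐ All (_< a))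

𝓢 : ∀ n → Pred ℕ ℓ → Pred (PartFun n) ℓ
𝓢 n A = (λ q → ∃[ f ] (f ∈ 𝓡 n × q ≈ ⌜ f ⌝)) ∪ Anf n A

universal : (ℕ → PartFun n) → PartFun (suc n)
universal ψ = record
  { Graph        = λ xs → Graph (ψ (head xs)) (tail xs)
  ; singleValued = λ {xs} → singleValued (ψ (head xs))
  }

fix-first : PartFun (suc n) → ℕ → PartFun n
fix-first g i = record
  { Graph        = λ xs y → Graph g (i ∷ xs) y
  ; singleValued = singleValued g
  }

record IsNumbering (X : Pred (PartFun n) ℓ) (ψ : ℕ → PartFun n) : Set (lsuc 0ℓ ⊔ ℓ) where
  field
    into : ∀ i → ψ i ∈ X
    onto : ∀ q → q ∈ X → ∃[ i ] ψ i ≈ q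

record IsGödelNumbering (φ : ℕ → PartFun n) : Set₁ where
  field
    isNumbering         : IsNumbering (𝒫 n) φ
    universalComputable : universal φ ∈ 𝒫 (suc n)
    translation         : ∀ g → g ∈ 𝒫 (suc n) →
                          ∃[ s ] (s ∈ 𝓡 1 × (∀ i → φ (s [ i ]) ≈ fix-first g i))

-- X ⊆ 𝒫 n is not a separate field: for a Gödel numbering φ it follows from
-- the surjectivity of ψ and ψ i ≈ φ (d [ i ]).

record IsStandardNumbering (φ : ℕ → PartFun n) (X : Pred (PartFun n) ℓ)
                           (ψ : ℕ → PartFun n) : Set (lsuc 0ℓ ⊔ ℓ) where
  field
    isNumbering : IsNumbering X ψ
    d           : Vec ℕ 1 → ℕ
    d∈𝓡         : d ∈ 𝓡 1
    factors     : ∀ i → ψ i ≈ φ (d [ i ])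
    fixes       : ∀ i → φ i ∈ X → φ (d [ i ]) ≈ φ i

binary : (ℕ → ℕ → ℕ) → Vec ℕ 2 → ℕ
binary f (x ∷ y ∷ []) = f x y

record Pairing : Set where
  field
    ⟨_,_⟩      : ℕ → ℕ → ℕ
    bijective  : Bijective _≡_ _≡_ (uncurry ⟨_,_⟩)
    computable : binary ⟨_,_⟩ ∈ 𝓡 2
    boundˡ     : ∀ x y → x ≤ ⟨ x , y ⟩
    boundʳ     : ∀ x y → y ≤ ⟨ x , y ⟩

  tuple : Vec ℕ (suc n) → ℕ
  tuple (x ∷ [])     = x
  tuple (x ∷ y ∷ ys) = ⟨ x , tuple (y ∷ ys) ⟩

  ExtendedGraph : PartFun (suc n) → Pred ℕ 0ℓ
  ExtendedGraph {n} q z = (∃[ ys ] z ≡ ⟨ tuple {n} ys , 0 ⟩)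
                        ⊎ (∃[ xs ] ∃[ w ] (Graph q xs w × z ≡ ⟨ tuple xs , suc w ⟩))

Range : (ℕ → ℕ) → Pred ℕ 0ℓ
Range f z = ∃[ t ] f t ≡ z

{-# OPTIONS --safe #-}

-- (QGN I) Since ψ_i = φ_{d(i)}, the function (i,x⃗) ↦ ψ_i(x⃗) is given by a code c. By
-- Kleene's normal form the value of c after s steps, coded as 0 when undefined and as
-- y + 1 otherwise, is a total computable function of s and i,x⃗. This is precisely the
-- coding of the extended graph, so ⟨⟨i,x⃗⟩,s⟩ ↦ ⟨⟨i,x⃗⟩,value after s steps⟩ enumerates it.
--
-- (QGN II) Searching k(i,0), k(i,1), … for an entry ⟨⟨x⃗⟩,y+1⟩ and returning y is partial
-- computable in i,x⃗, so it is φ_{v(i)}(x⃗) for a computable v. If k(i,·) enumerates the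
-- extended graph of r ∈ 𝓢, then φ_{v(i)} = r ∈ 𝓢, and so ψ_{v(i)} = φ_{d(v(i))} = φ_{v(i)} = r.

module Submission where

open import Data.Empty using (⊥-elim)
open import Data.Fin using (Fin; zero; suc; _↑ʳ_; #_)
open import Data.Nat using (ℕ; zero; suc; pred; _∸_; _+_; _⊔_; _≤_; _<_; _≤′_; ≤′-refl; ≤′-step; s≤s)
open import Data.Nat.Properties
open import Data.Product using (∃-syntax; _×_; _,_; proj₁; proj₂; map₂)
open import Data.Product.Properties using (,-injectiveˡ; ,-injectiveʳ)
open import Data.Sum using (inj₁; inj₂)
open import Data.Vec using (Vec; []; _∷_; [_]; head; tail; lookup; tabulate)
open import Data.Vec.Relation.Binary.Pointwise.Inductive using (Pointwise; []; _∷_)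
open import Function using (_∘_)
open import Function.Bundles using (_⇔_; mk⇔; module Equivalence)
import Function.Properties.Equivalence as ⇔
open import Level using (Level)
open import Relation.Binary.Definitions using (tri<; tri≈; tri>)
open import Relation.Binary.PropositionalEquality using (_≡_; _≢_; refl; sym; trans; cong; cong₂; subst; subst₂)
open import Relation.Nullary using (yes; no)
open import Relation.Unary using (Pred; _∈_; _≐_)
open import Defs

open Equivalence using (to; from)

private
  variable
    m n : ℕ

-- Determinism of evaluation.

⇓-functional : (c : Code n) {xs : Vec ℕ n} {y z : ℕ} → c [ xs ]⇓ y → c [ xs ]⇓ z → y ≡ z
⇓-functionals : (cs : Vec (Code n) m) {xs : Vec ℕ n} {ys zs : Vec ℕ m} →
                Pointwise (λ c y → c [ xs ]⇓ y) cs ys → Pointwise (λ c z → c [ xs ]⇓ z) cs zs → ys ≡ zs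

⇓-functional zero zero⇓ zero⇓ = refl
⇓-functional suc suc⇓ suc⇓ = refl
⇓-functional (proj i) (proj⇓ .i) (proj⇓ .i) = refl
⇓-functional (comp f gs) (comp⇓ ps p) (comp⇓ qs q) with ⇓-functionals gs ps qs
... | refl = ⇓-functional f p q
⇓-functional (rec f g) (rec⇓₀ p) (rec⇓₀ q) = ⇓-functional f p q
⇓-functional (rec f g) (rec⇓₊ p p′) (rec⇓₊ q q′) with ⇓-functional (rec f g) p q
... | refl = ⇓-functional g p′ q′
⇓-functional (μ f) {y = y} {z = z} (μ⇓ below p) (μ⇓ below′ q) with <-cmp y z
... | tri≈ _ y≡z _ = y≡z
-- At the smaller of the two results `f` is 0, whereas the search that ends later demands a
-- successor there.
... | tri< y<z _ _ = ⊥-elim (0≢1+n (⇓-functional f p (proj₂ (below′ y y<z))))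
... | tri> _ _ z<y = ⊥-elim (0≢1+n (⇓-functional f q (proj₂ (below z z<y))))

⇓-functionals [] [] [] = refl
⇓-functionals (c ∷ cs) (p ∷ ps) (q ∷ qs) = cong₂ _∷_ (⇓-functional c p q) (⇓-functionals cs ps qs)

-- Total computable functions

-- A function travels with its code, so that the combinators build both at once and most identities
-- about `fun` hold by computation.
record Total (n : ℕ) : Set where
  field
    fun     : Vec ℕ n → ℕ
    code    : Code n
    correct : ∀ xs → code [ xs ]⇓ fun xs

open Total

record Totals (n m : ℕ) : Set where
  field
    funs     : Vec ℕ n → Vec ℕ m
    codes    : Vec (Code n) m
    corrects : ∀ xs → Pointwise (λ c y → c [ xs ]⇓ y) codes (funs xs)

open Totals

⇓⇔ : (t : Total n) → ∀ xs y → code t [ xs ]⇓ y ⇔ fun t xs ≡ y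
⇓⇔ t xs y = mk⇔ (⇓-functional (code t) (correct t xs)) λ { refl → correct t xs }

fun∈𝓡 : (t : Total n) → fun t ∈ 𝓡 n
fun∈𝓡 t = code t , ⇓⇔ t

fromᴿ : {f : Vec ℕ n → ℕ} → f ∈ 𝓡 n → Total n
fromᴿ {f = f} (c , c⇔f) = record { fun = f ; code = c ; correct = λ xs → from (c⇔f xs (f xs)) refl }

comp⇓⇔ : (f : Code m) (gs : Totals n m) → ∀ xs y → comp f (codes gs) [ xs ]⇓ y ⇔ f [ funs gs xs ]⇓ y
comp⇓⇔ f gs xs y = mk⇔ inner (comp⇓ (corrects gs xs))
  where
  inner : comp f (codes gs) [ xs ]⇓ y → f [ funs gs xs ]⇓ y
  inner (comp⇓ ps p) with ⇓-functionals (codes gs) ps (corrects gs xs)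
  ... | refl = p

-- Totality of `t` settles the convergence clause of `μ⇓`, leaving a condition on values alone.
μ⇓⇔ : (t : Total (suc n)) → ∀ xs y →
      μ (code t) [ xs ]⇓ y ⇔ ((∀ k → k < y → fun t (k ∷ xs) ≢ 0) × fun t (y ∷ xs) ≡ 0)
μ⇓⇔ t xs y = mk⇔ least search
  where
  least : μ (code t) [ xs ]⇓ y → (∀ k → k < y → fun t (k ∷ xs) ≢ 0) × fun t (y ∷ xs) ≡ 0
  least (μ⇓ below p) =
    (λ k k<y e → 0≢1+n (trans (sym e) (to (⇓⇔ t _ _) (proj₂ (below k k<y))))) , to (⇓⇔ t _ _) p

  search : (∀ k → k < y → fun t (k ∷ xs) ≢ 0) × fun t (y ∷ xs) ≡ 0 → μ (code t) [ xs ]⇓ y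
  search (below , p) = μ⇓ (λ k k<y → positive k (below k k<y)) (from (⇓⇔ t _ _) p)
    where
    positive : ∀ k → fun t (k ∷ xs) ≢ 0 → ∃[ w ] code t [ k ∷ xs ]⇓ suc w
    positive k k≢0 with fun t (k ∷ xs) | correct t (k ∷ xs)
    ... | zero  | _ = ⊥-elim (k≢0 refl)
    ... | suc w | p = w , p

[]ᵗ : Totals n 0
[]ᵗ = record { funs = λ _ → [] ; codes = [] ; corrects = λ _ → [] }

infixr 5 _∷ᵗ_

_∷ᵗ_ : Total n → Totals n m → Totals n (suc m)
t ∷ᵗ ts = record
  { funs     = λ xs → fun t xs ∷ funs ts xs
  ; codes    = code t ∷ codes ts
  ; corrects = λ xs → correct t xs ∷ corrects ts xs
  }

projections⇓ : (ι : Fin m → Fin n) (xs : Vec ℕ n) (ys : Vec ℕ m) → (∀ i → lookup xs (ι i) ≡ lookup ys i) →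
               Pointwise (λ c y → c [ xs ]⇓ y) (tabulate (proj ∘ ι)) ys
projections⇓ ι xs []       eq = []
projections⇓ ι xs (y ∷ ys) eq =
  subst (proj (ι zero) [ xs ]⇓_) (eq zero) (proj⇓ (ι zero)) ∷ projections⇓ (ι ∘ suc) xs ys (eq ∘ suc)

dropFirst : ∀ k → Vec ℕ (k + n) → Vec ℕ n
dropFirst zero    xs = xs
dropFirst (suc k) xs = dropFirst k (tail xs)

lookup-dropFirst : ∀ k (xs : Vec ℕ (k + n)) i → lookup xs (k ↑ʳ i) ≡ lookup (dropFirst k xs) i
lookup-dropFirst zero    xs       i = refl
lookup-dropFirst (suc k) (x ∷ xs) i = lookup-dropFirst k xs i

-- Serves as weakening by `k` variables; `dropᵗ 0` is the identity tuple.
dropᵗ : ∀ k → Totals (k + n) n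
dropᵗ k = record
  { funs     = dropFirst k
  ; codes    = tabulate (proj ∘ (k ↑ʳ_))
  ; corrects = λ xs → projections⇓ (k ↑ʳ_) xs (dropFirst k xs) (lookup-dropFirst k xs)
  }

app : Total m → Totals n m → Total n
app t ts = record
  { fun     = λ xs → fun t (funs ts xs)
  ; code    = comp (code t) (codes ts)
  ; correct = λ xs → comp⇓ (corrects ts xs) (correct t (funs ts xs))
  }

varᵗ : Fin n → Total n
varᵗ i = record { fun = λ xs → lookup xs i ; code = proj i ; correct = λ _ → proj⇓ i }

zeroᵗ : Total n
zeroᵗ = record { fun = λ _ → 0 ; code = zero ; correct = λ _ → zero⇓ }

sucᵗ : Total n → Total n
sucᵗ t = record
  { fun     = λ xs → suc (fun t xs)
  ; code    = comp suc (code t ∷ [])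
  ; correct = λ xs → comp⇓ (correct t xs ∷ []) suc⇓
  }

natrec : ℕ → (ℕ → ℕ → ℕ) → ℕ → ℕ
natrec b s zero    = b
natrec b s (suc k) = s k (natrec b s k)

natrecᵗ : Total n → Total n → Total (suc (suc n)) → Total n
natrecᵗ {n} a b s = record
  { fun     = λ xs → value xs (fun a xs)
  ; code    = comp (rec (code b) (code s)) (codes (a ∷ᵗ dropᵗ 0))
  ; correct = λ xs → comp⇓ (corrects (a ∷ᵗ dropᵗ 0) xs) (value⇓ xs (fun a xs))
  }
  where
  value : Vec ℕ n → ℕ → ℕ
  value xs = natrec (fun b xs) (λ k y → fun s (k ∷ y ∷ xs))

  value⇓ : ∀ xs k → rec (code b) (code s) [ k ∷ xs ]⇓ value xs k
  value⇓ xs zero    = rec⇓₀ (correct b xs)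
  value⇓ xs (suc k) = rec⇓₊ (value⇓ xs k) (correct s _)

caseℕ : ℕ → (ℕ → ℕ) → ℕ → ℕ
caseℕ b s zero    = b
caseℕ b s (suc k) = s k

caseᵗ : Total n → Total n → Total (suc n) → Total n
caseᵗ {n} a b s = record
  { fun     = λ xs → value xs (fun a xs)
  ; code    = comp (rec (code b) (code s′)) (codes (a ∷ᵗ dropᵗ 0))
  ; correct = λ xs → comp⇓ (corrects (a ∷ᵗ dropᵗ 0) xs) (value⇓ xs (fun a xs))
  }
  where
  s′ : Total (suc (suc n))
  -- The second variable, the value of the recursion so far, is discarded; this turns primitive
  -- recursion into a case distinction.
  s′ = app s (varᵗ (# 0) ∷ᵗ dropᵗ 2)

  value : Vec ℕ n → ℕ → ℕ
  value xs = caseℕ (fun b xs) (λ k → fun s (k ∷ xs))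

  value⇓ : ∀ xs k → rec (code b) (code s′) [ k ∷ xs ]⇓ value xs k
  value⇓ xs zero    = rec⇓₀ (correct b xs)
  value⇓ xs (suc k) = rec⇓₊ (value⇓ xs k) (correct s′ _)

-- A unique zero is also the least one, so `μ` computes `h`. This is how the inverses of the pairing
-- become computable.
searchᵗ : (t : Total (suc n)) (h : Vec ℕ n → ℕ) →
          (∀ xs → fun t (h xs ∷ xs) ≡ 0) → (∀ xs k → fun t (k ∷ xs) ≡ 0 → k ≡ h xs) → Total n
searchᵗ t h root unique = record
  { fun     = h
  ; code    = μ (code t)
  ; correct = λ xs → from (μ⇓⇔ t xs (h xs)) ((λ k k<h e → <⇒≢ k<h (unique xs k e)) , root xs)
  }

-- Equality tests and bounded search.

predᵗ : Total n → Total n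
predᵗ t = caseᵗ t zeroᵗ (varᵗ (# 0))

monusᵗ : Total n → Total n → Total n
monusᵗ a b = natrecᵗ b a (predᵗ (varᵗ (# 1)))

fun-predᵗ : (t : Total n) → ∀ xs → fun (predᵗ t) xs ≡ pred (fun t xs)
fun-predᵗ t xs with fun t xs
... | zero  = refl
... | suc _ = refl

fun-monusᵗ : (a b : Total n) → ∀ xs → fun (monusᵗ a b) xs ≡ fun a xs ∸ fun b xs
fun-monusᵗ {n} a b xs = go (fun b xs)
  where
  step : Total (suc (suc n))
  step = predᵗ (varᵗ (# 1))

  value : ℕ → ℕ
  value = natrec (fun a xs) (λ k y → fun step (k ∷ y ∷ xs))

  go : ∀ k → value k ≡ fun a xs ∸ k
  go zero    = refl
  go (suc k) = trans (fun-predᵗ (varᵗ (# 1)) (k ∷ value k ∷ xs))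
                     (trans (cong pred (go k)) (pred[m∸n]≡m∸[1+n] (fun a xs) k))

-- Tests read 0 as true, since `μ` looks for zeros: equality means that both truncated differences
-- vanish.
diffᵗ : Total n → Total n → Total n
diffᵗ a b = caseᵗ (monusᵗ a b) (monusᵗ b a) (sucᵗ zeroᵗ)

diffᵗ≡0 : (a b : Total n) → ∀ xs → fun (diffᵗ a b) xs ≡ 0 ⇔ fun a xs ≡ fun b xs
diffᵗ≡0 a b xs = mk⇔ equal zero-if-equal
  where
  equal : fun (diffᵗ a b) xs ≡ 0 → fun a xs ≡ fun b xs
  equal e with fun (monusᵗ a b) xs in a∸b
  ... | zero = ≤-antisym (m∸n≡0⇒m≤n (trans (sym (fun-monusᵗ a b xs)) a∸b))
                         (m∸n≡0⇒m≤n (trans (sym (fun-monusᵗ b a xs)) e))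

  zero-if-equal : fun a xs ≡ fun b xs → fun (diffᵗ a b) xs ≡ 0
  zero-if-equal e with fun (monusᵗ a b) xs in a∸b
  ... | zero  = trans (fun-monusᵗ b a xs) (m≤n⇒m∸n≡0 (≤-reflexive (sym e)))
  ... | suc _ = ⊥-elim (0≢1+n (trans (sym (trans (fun-monusᵗ a b xs) (m≤n⇒m∸n≡0 (≤-reflexive e)))) a∸b))

-- Induction on `t`, passing to `f ∘ suc` while `f 0` is nonzero. It turns any zero into the one at
-- which `μ` stops.
least-zero : ∀ (f : ℕ → ℕ) t → f t ≡ 0 → ∃[ t₀ ] ((∀ k → k < t₀ → f k ≢ 0) × f t₀ ≡ 0)
least-zero f zero e = 0 , (λ _ ()) , e
least-zero f (suc t) e with f 0 in f0
... | zero  = 0 , (λ _ ()) , f0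
... | suc _ with least-zero (f ∘ suc) t e
...   | t₀ , below , e′ = suc t₀ , below′ , e′
  where
  below′ : ∀ k → k < suc t₀ → f k ≢ 0
  below′ zero    _         e = 0≢1+n (trans (sym e) f0)
  below′ (suc k) (s≤s k<t₀)  = below k k<t₀

-- The accumulator starts at 1 (false), drops to 0 at a zero of `t`, and is otherwise kept; `# 2` is
-- this accumulator, behind the predecessor bound by the case distinction and the counter.
someBelowᵗ : Total n → Total (suc n) → Total n
someBelowᵗ b t = natrecᵗ b (sucᵗ zeroᵗ) (caseᵗ (app t (varᵗ (# 0) ∷ᵗ dropᵗ 2)) zeroᵗ (varᵗ (# 2)))

someBelowᵗ≡0 : (b : Total n) (t : Total (suc n)) → ∀ xs →
               fun (someBelowᵗ b t) xs ≡ 0 ⇔ (∃[ k ] (k < fun b xs × fun t (k ∷ xs) ≡ 0))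
someBelowᵗ≡0 b t xs = mk⇔ (witness (fun b xs)) (λ (k , k<b , e) → found (fun b xs) k k<b e)
  where
  value : ℕ → ℕ
  value = natrec 1 (λ k r → caseℕ 0 (λ _ → r) (fun t (k ∷ xs)))

  witness : ∀ j → value j ≡ 0 → ∃[ k ] (k < j × fun t (k ∷ xs) ≡ 0)
  witness (suc j) e with fun t (j ∷ xs) in eq
  ... | zero  = j , ≤-refl , eq
  ... | suc _ with witness j e
  ...   | k , k<j , e′ = k , m<n⇒m<1+n k<j , e′

  found : ∀ j k → k < j → fun t (k ∷ xs) ≡ 0 → value j ≡ 0
  found (suc j) k k<j e with fun t (j ∷ xs) in eq
  ... | zero  = refl
  ... | suc _ = found j k (≤∧≢⇒< (≤-pred k<j) λ { refl → 0≢1+n (trans (sym e) eq) }) e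

-- Kleene's normal form

-- `app` alone would go on computing with arguments that are not finished; here one unfinished
-- argument forces the result 0.
guardᵗ : Vec (Total n) m → Total n → Total n
guardᵗ []       t = t
guardᵗ (g ∷ gs) t = caseᵗ g zeroᵗ (app (guardᵗ gs t) (dropᵗ 1))

-- Decodes a finished `suc y` to `y`. An unfinished argument becomes 0, a default that `guardᵗ`
-- keeps from mattering.
predsᵗ : Vec (Total n) m → Totals n m
predsᵗ []       = []ᵗ
predsᵗ (g ∷ gs) = predᵗ g ∷ᵗ predsᵗ gs

-- stage c (s ∷ xs) is 0 if the computation of c on xs is not finished at stage s,
-- and suc y if it has finished with the value y. The same convention encodes the
-- intermediate values of a primitive recursion. During the search for a zero of f,
-- 0 stands for "searching", 1 for "f was not yet defined", and 2 + y for "found y".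
stage : Code n → Total (suc n)
stages : Vec (Code n) m → Vec (Total (suc n)) m

stage zero        = sucᵗ zeroᵗ
stage suc         = sucᵗ (sucᵗ (varᵗ (# 1)))
stage (proj i)    = sucᵗ (varᵗ (suc i))
stage (comp f gs) = guardᵗ (stages gs) (app (stage f) (varᵗ (# 0) ∷ᵗ predsᵗ (stages gs)))
stage (rec f g)   =
  natrecᵗ (varᵗ (# 1))
    (app (stage f) (varᵗ (# 0) ∷ᵗ dropᵗ 2))
    (caseᵗ (varᵗ (# 1)) zeroᵗ
      (app (stage g) (varᵗ (# 3) ∷ᵗ varᵗ (# 1) ∷ᵗ varᵗ (# 0) ∷ᵗ dropᵗ 5)))
stage (μ f)       =
  predᵗ (natrecᵗ (varᵗ (# 0)) zeroᵗ
    (caseᵗ (varᵗ (# 1))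
      (caseᵗ (app (stage f) (varᵗ (# 2) ∷ᵗ varᵗ (# 0) ∷ᵗ dropᵗ 3))
        (sucᵗ zeroᵗ)
        (caseᵗ (varᵗ (# 0)) (sucᵗ (sucᵗ (varᵗ (# 1)))) zeroᵗ))
      (sucᵗ (varᵗ (# 0)))))

stages []       = []
stages (g ∷ gs) = stage g ∷ stages gs

-- Names the recursion inside `stage (rec f g)`, with which it agrees by computation. The innermost
-- variables there are `y ∷ j ∷ r ∷ s ∷ k ∷ xs`, where `r` is the coded previous value and `y` its
-- predecessor.
module RecStage (f : Code n) (g : Code (suc (suc n))) (s : ℕ) (xs : Vec ℕ n) where
  value : ℕ → ℕ
  value = natrec (fun (stage f) (s ∷ xs))
                 (λ j → caseℕ 0 (λ y → fun (stage g) (s ∷ j ∷ y ∷ xs)))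

-- The search inside `stage (μ f)`. The number `s` does double duty: it is the stage at which `f` is
-- run and the number of candidates `j` that are tried.
module SearchStage (f : Code (suc n)) (s : ℕ) (xs : Vec ℕ n) where
  step : ℕ → ℕ → ℕ
  step j = caseℕ (caseℕ 1 (caseℕ (suc (suc j)) (λ _ → 0)) (fun (stage f) (s ∷ j ∷ xs))) suc

  state : ℕ → ℕ
  state = natrec 0 step

stage-sound : (c : Code n) (s : ℕ) (xs : Vec ℕ n) {y : ℕ} → fun (stage c) (s ∷ xs) ≡ suc y → c [ xs ]⇓ y
-- A successor passes the guard only when every argument has finished, so the decoded values are
-- genuine.
stages-sound : (gs : Vec (Code n) m) (s : ℕ) (xs : Vec ℕ n) (t : Total (suc n)) {z : ℕ} →
               fun (guardᵗ (stages gs) t) (s ∷ xs) ≡ suc z →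
               Pointwise (λ g y → g [ xs ]⇓ y) gs (funs (predsᵗ (stages gs)) (s ∷ xs)) ×
               fun t (s ∷ xs) ≡ suc z

stage-sound zero s xs refl = zero⇓
stage-sound suc s (x ∷ []) refl = suc⇓
stage-sound (proj i) s xs refl = proj⇓ i
stage-sound (comp f gs) s xs e with stages-sound gs s xs _ e
... | ps , e′ = comp⇓ ps (stage-sound f s _ e′)
stage-sound (rec f g) s (k ∷ xs) e = go k e
  where
  open RecStage f g s xs
  go : ∀ k {y} → value k ≡ suc y → rec f g [ k ∷ xs ]⇓ y
  go zero    e = rec⇓₀ (stage-sound f s xs e)
  go (suc k) e with value k in eq
  ... | suc y = rec⇓₊ (go k eq) (stage-sound g s (k ∷ y ∷ xs) e)
stage-sound (μ f) s xs e = found e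
  where
  open SearchStage f s xs
  -- State 1 certifies nothing: the search is stuck at an undefined value and stays so for this `s`.
  Invariant : ℕ → ℕ → Set
  Invariant j r = (r ≡ 0 → ∀ k → k < j → ∃[ w ] f [ k ∷ xs ]⇓ suc w) ×
                  (∀ y → r ≡ suc (suc y) → μ f [ xs ]⇓ y)

  invariant : ∀ j → Invariant j (state j)
  invariant zero = (λ _ _ ()) , λ _ ()
  invariant (suc j) with state j | invariant j
  ... | suc r | _ , found = (λ ()) , found
  ... | zero  | below , _ with fun (stage f) (s ∷ j ∷ xs) in eq
  -- The codes 0, 1 and `suc (suc w)` mean that `f` is undefined so far, is 0, or is `suc w`: the
  -- search gets stuck, succeeds, or moves on.
  ...   | zero        = (λ ()) , λ _ ()
  ...   | suc zero    = (λ ()) , λ { _ refl → μ⇓ (below refl) (stage-sound f s _ eq) }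
  ...   | suc (suc w) = (λ _ → below′) , λ _ ()
    where
    below′ : ∀ k → k < suc j → ∃[ w ] f [ k ∷ xs ]⇓ suc w
    below′ k k<1+j with k ≟ j
    ... | yes refl = w , stage-sound f s _ eq
    ... | no k≢j   = below refl k (≤∧≢⇒< (≤-pred k<1+j) k≢j)

  found : ∀ {y} → caseℕ 0 (λ r → r) (state s) ≡ suc y → μ f [ xs ]⇓ y
  found e with state s | invariant s
  found refl | suc _ | _ , found = found _ refl

stages-sound [] s xs t e = [] , e
stages-sound (g ∷ gs) s xs t e with fun (stage g) (s ∷ xs) in eq
... | suc y with stages-sound gs s xs t e
...   | ps , e′ = stage-sound g s xs eq ∷ ps , e′

-- Demanding all late stages rather than one lets several computations share a stage without a
-- separate proof that `stage` is monotone.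
Eventually : (ℕ → Set) → Set
Eventually P = ∃[ s₀ ] (∀ s → s₀ ≤ s → P s)

eventually-map : {P Q : ℕ → Set} → (∀ s → P s → Q s) → Eventually P → Eventually Q
eventually-map f = map₂ (λ p s s₀≤s → f s (p s s₀≤s))

eventually-× : {P Q : ℕ → Set} → Eventually P → Eventually Q → Eventually (λ s → P s × Q s)
eventually-× (a , p) (b , q) =
  a ⊔ b , λ s le → p s (≤-trans (m≤m⊔n a b) le) , q s (≤-trans (m≤n⊔m a b) le)

eventually-below : {P : ℕ → ℕ → Set} → ∀ j → (∀ k → k < j → Eventually (P k)) →
                   Eventually (λ s → ∀ k → k < j → P k s)
eventually-below zero    h = 0 , λ _ _ _ ()
eventually-below {P} (suc j) h =
  eventually-map extend (eventually-× (eventually-below j (λ k k<j → h k (m<n⇒m<1+n k<j))) (h j ≤-refl))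
  where
  extend : ∀ s → (∀ k → k < j → P k s) × P j s → ∀ k → k < suc j → P k s
  extend s (below , at) k k<1+j with k ≟ j
  ... | yes refl = at
  ... | no k≢j   = below k (≤∧≢⇒< (≤-pred k<1+j) k≢j)

-- Induction on the code, and for `rec` also on the derivation, whose recursion argument decreases
-- while the code stays the same.
stage-complete : (c : Code n) {xs : Vec ℕ n} {y : ℕ} → c [ xs ]⇓ y →
                 Eventually (λ s → fun (stage c) (s ∷ xs) ≡ suc y)
-- Once all arguments have finished, the guard is transparent. Quantifying over `t` inside makes the
-- bound independent of what is guarded.
stages-complete : (gs : Vec (Code n) m) {xs : Vec ℕ n} {ys : Vec ℕ m} →
                  Pointwise (λ g y → g [ xs ]⇓ y) gs ys →
                  Eventually (λ s → funs (predsᵗ (stages gs)) (s ∷ xs) ≡ ys ×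
                                    (∀ t → fun (guardᵗ (stages gs) t) (s ∷ xs) ≡ fun t (s ∷ xs)))

stage-complete zero zero⇓ = 0 , λ _ _ → refl
stage-complete suc suc⇓ = 0 , λ _ _ → refl
stage-complete (proj i) (proj⇓ .i) = 0 , λ _ _ → refl
stage-complete (comp f gs) (comp⇓ ps p) =
  eventually-map (λ { s ((refl , unguard) , e) → trans (unguard _) e })
                 (eventually-× (stages-complete gs ps) (stage-complete f p))
stage-complete (rec f g) (rec⇓₀ p) = stage-complete f p
stage-complete (rec f g) {suc k ∷ xs} (rec⇓₊ {y = y} {z = z} p q) =
  eventually-map (λ s (e , e′) → next s e e′)
                 (eventually-× (stage-complete (rec f g) p) (stage-complete g q))
  where
  next : ∀ s → RecStage.value f g s xs k ≡ suc y → fun (stage g) (s ∷ k ∷ y ∷ xs) ≡ suc z →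
         RecStage.value f g s xs (suc k) ≡ suc z
  next s e e′ rewrite e = e′
stage-complete (μ f) {xs} {y} (μ⇓ below p) =
  eventually-map (λ s ((before , at) , y<s) → finish s before at y<s)
    (eventually-×
      (eventually-× (eventually-below y (λ k k<y → positive k (below k k<y))) (stage-complete f p))
      -- Stage `s` tries only candidates below `s`, so `y` is reached only if `y < s`.
      (suc y , λ _ y<s → y<s))
  where
  Positive : ℕ → ℕ → Set
  Positive k s = ∃[ w ] fun (stage f) (s ∷ k ∷ xs) ≡ suc (suc w)

  positive : ∀ k → ∃[ w ] f [ k ∷ xs ]⇓ suc w → Eventually (Positive k)
  positive k (w , p) = eventually-map (λ _ e → w , e) (stage-complete f p)

  finish : ∀ s → (∀ k → k < y → Positive k s) → fun (stage f) (s ∷ y ∷ xs) ≡ 1 → y < s →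
           fun (stage (μ f)) (s ∷ xs) ≡ suc y
  finish s before at y<s = cong (caseℕ 0 (λ r → r)) (found (≤⇒≤′ y<s))
    where
    open SearchStage f s xs
    searching : ∀ j → j ≤ y → state j ≡ 0
    searching zero    _ = refl
    searching (suc j) j<y with before j j<y
    ... | w , e rewrite searching j (<⇒≤ j<y) | e = refl

    -- Round `y` writes `suc (suc y)`, and every later round copies it.
    found : ∀ {j} → suc y ≤′ j → state j ≡ suc (suc y)
    found ≤′-refl rewrite searching y ≤-refl | at = refl
    found (≤′-step y<j) rewrite found y<j = refl

stages-complete [] [] = 0 , λ _ _ → refl , λ _ → refl
stages-complete (g ∷ gs) {xs} {y ∷ ys} (p ∷ ps) =
  eventually-map (λ s (e , es , unguard) → next s e es unguard)
                 (eventually-× (stage-complete g p) (stages-complete gs ps))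
  where
  next : ∀ s → fun (stage g) (s ∷ xs) ≡ suc y → funs (predsᵗ (stages gs)) (s ∷ xs) ≡ ys →
         (∀ t → fun (guardᵗ (stages gs) t) (s ∷ xs) ≡ fun t (s ∷ xs)) →
         funs (predsᵗ (stages (g ∷ gs))) (s ∷ xs) ≡ y ∷ ys ×
         (∀ t → fun (guardᵗ (stages (g ∷ gs)) t) (s ∷ xs) ≡ fun t (s ∷ xs))
  next s e es unguard rewrite e = cong (y ∷_) es , unguard

-- Pairs and tuples

module Tupling (π : Pairing) where
  open Pairing π

  ⟨,⟩-injective : ∀ {x y x′ y′} → ⟨ x , y ⟩ ≡ ⟨ x′ , y′ ⟩ → (x , y) ≡ (x′ , y′)
  ⟨,⟩-injective = proj₁ bijective

  unpair : ℕ → ℕ × ℕ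
  unpair z = proj₁ (proj₂ bijective z)

  fst snd : ℕ → ℕ
  fst = proj₁ ∘ unpair
  snd = proj₂ ∘ unpair

  ⟨fst,snd⟩ : ∀ z → ⟨ fst z , snd z ⟩ ≡ z
  ⟨fst,snd⟩ z = proj₂ (proj₂ bijective z) refl

  unpair-⟨,⟩ : ∀ x y → unpair ⟨ x , y ⟩ ≡ (x , y)
  unpair-⟨,⟩ x y = ⟨,⟩-injective (⟨fst,snd⟩ ⟨ x , y ⟩)

  pairᵗ : Total n → Total n → Total n
  pairᵗ a b = app (fromᴿ computable) (a ∷ᵗ b ∷ᵗ []ᵗ)

  -- The first component is searched for without bound, the second below `suc z`; the bounded inner
  -- search keeps the test total.
  fst₁ : Total 1
  fst₁ = searchᵗ test (λ xs → fst (head xs)) root unique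
    where
    match : Total 3
    match = diffᵗ (pairᵗ (varᵗ (# 1)) (varᵗ (# 0))) (varᵗ (# 2))

    test : Total 2
    test = someBelowᵗ (sucᵗ (varᵗ (# 1))) match

    root : ∀ xs → fun test (fst (head xs) ∷ xs) ≡ 0
    root (z ∷ []) = from (someBelowᵗ≡0 (sucᵗ (varᵗ (# 1))) match (fst z ∷ z ∷ []))
      ( snd z
      -- `boundʳ` permits equality with `z`, whence the bound `suc z`.
      , s≤s (subst (snd z ≤_) (⟨fst,snd⟩ z) (boundʳ (fst z) (snd z)))
      , from (diffᵗ≡0 (pairᵗ (varᵗ (# 1)) (varᵗ (# 0))) (varᵗ (# 2)) (snd z ∷ fst z ∷ z ∷ [])) (⟨fst,snd⟩ z) )

    unique : ∀ xs k → fun test (k ∷ xs) ≡ 0 → k ≡ fst (head xs)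
    unique (z ∷ []) k e with to (someBelowᵗ≡0 (sucᵗ (varᵗ (# 1))) match (k ∷ z ∷ [])) e
    ... | y , _ , e′ = ,-injectiveˡ (⟨,⟩-injective (trans
          (to (diffᵗ≡0 (pairᵗ (varᵗ (# 1)) (varᵗ (# 0))) (varᵗ (# 2)) (y ∷ k ∷ z ∷ [])) e′)
          (sym (⟨fst,snd⟩ z))))

  fstᵗ : Total n → Total n
  fstᵗ t = app fst₁ (t ∷ᵗ []ᵗ)

  snd₁ : Total 1
  snd₁ = searchᵗ (diffᵗ candidate (varᵗ (# 1))) (λ xs → snd (head xs)) root unique
    where
    candidate : Total 2
    candidate = pairᵗ (fstᵗ (varᵗ (# 1))) (varᵗ (# 0))

    root : ∀ xs → fun (diffᵗ candidate (varᵗ (# 1))) (snd (head xs) ∷ xs) ≡ 0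
    root (z ∷ []) = from (diffᵗ≡0 candidate (varᵗ (# 1)) (snd z ∷ z ∷ [])) (⟨fst,snd⟩ z)

    unique : ∀ xs k → fun (diffᵗ candidate (varᵗ (# 1))) (k ∷ xs) ≡ 0 → k ≡ snd (head xs)
    unique (z ∷ []) k e = ,-injectiveʳ (⟨,⟩-injective (trans
      (to (diffᵗ≡0 candidate (varᵗ (# 1)) (k ∷ z ∷ [])) e) (sym (⟨fst,snd⟩ z))))

  sndᵗ : Total n → Total n
  sndᵗ t = app snd₁ (t ∷ᵗ []ᵗ)

  tuple-injective : {xs ys : Vec ℕ (suc n)} → tuple xs ≡ tuple ys → xs ≡ ys
  tuple-injective {xs = x ∷ []} {y ∷ []} e = cong [_] e
  tuple-injective {xs = x ∷ x′ ∷ xs} {y ∷ y′ ∷ ys} e =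
    cong₂ _∷_ (,-injectiveˡ (⟨,⟩-injective e)) (tuple-injective (,-injectiveʳ (⟨,⟩-injective e)))

  tupleᵗ : ∀ n → Total (suc n)
  tupleᵗ zero    = varᵗ (# 0)
  tupleᵗ (suc n) = pairᵗ (varᵗ (# 0)) (app (tupleᵗ n) (dropᵗ 1))

  fun-tupleᵗ : ∀ n xs → fun (tupleᵗ n) xs ≡ tuple xs
  fun-tupleᵗ zero    (x ∷ [])      = refl
  fun-tupleᵗ (suc n) (x ∷ y ∷ ys) = cong ⟨ x ,_⟩ (fun-tupleᵗ n (y ∷ ys))

  untupleᵗ : ∀ m → Total n → Totals n (suc m)
  untupleᵗ zero    t = t ∷ᵗ []ᵗ
  untupleᵗ (suc m) t = fstᵗ t ∷ᵗ untupleᵗ m (sndᵗ t)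

  tuple-untupleᵗ : ∀ m (t : Total n) xs → tuple (funs (untupleᵗ m t) xs) ≡ fun t xs
  tuple-untupleᵗ zero          t xs = refl
  -- Length two is separate because `tuple` reduces on the remaining entries only once it is known
  -- whether there is more than one.
  tuple-untupleᵗ (suc zero)    t xs = ⟨fst,snd⟩ (fun t xs)
  tuple-untupleᵗ (suc (suc m)) t xs =
    trans (cong ⟨ fst (fun t xs) ,_⟩ (tuple-untupleᵗ (suc m) (sndᵗ t) xs)) (⟨fst,snd⟩ (fun t xs))

  -- Enumerating an extended graph.

  -- Soundness of the stages keeps the range inside the extended graph; completeness makes it
  -- exhaust the graph.
  extendedGraph-enumerable : (q : PartFun (suc n)) → q ∈ 𝒫 (suc n) →
                             ∃[ f ] (f ∈ 𝓡 1 × Range (λ t → f [ t ]) ≐ ExtendedGraph q)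
  extendedGraph-enumerable {n} q (c , c⇔q) =
    fun enumᵗ , fun∈𝓡 enumᵗ , (λ { (t , refl) → enum∈ t }) , enumerated
    where
    -- The stage is shifted by one so that every ⟨⟨y⃗⟩,0⟩ is enumerated, even if c
    -- converges on y⃗ at stage 0.
    shiftedᵗ : Total (suc (suc n))
    shiftedᵗ = caseᵗ (varᵗ (# 0)) zeroᵗ (app (stage c) (varᵗ (# 0) ∷ᵗ dropᵗ 2))

    args : Totals 1 (suc n)
    args = untupleᵗ n (fstᵗ (varᵗ (# 0)))

    enumᵗ : Total 1
    enumᵗ = pairᵗ (fstᵗ (varᵗ (# 0))) (app shiftedᵗ (sndᵗ (varᵗ (# 0)) ∷ᵗ args))

    tuple-args : ∀ t → tuple (funs args [ t ]) ≡ fst t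
    tuple-args t = tuple-untupleᵗ n (fstᵗ (varᵗ (# 0))) [ t ]

    args-⟨,⟩ : ∀ xs s → funs args [ ⟨ tuple xs , s ⟩ ] ≡ xs
    args-⟨,⟩ xs s = tuple-injective (trans (tuple-args _) (cong proj₁ (unpair-⟨,⟩ (tuple xs) s)))

    enum-⟨,⟩ : ∀ xs s → fun enumᵗ [ ⟨ tuple xs , s ⟩ ] ≡ ⟨ tuple xs , fun shiftedᵗ (s ∷ xs) ⟩
    enum-⟨,⟩ xs s rewrite args-⟨,⟩ xs s | unpair-⟨,⟩ (tuple xs) s = refl

    shifted∈ : ∀ xs s → ExtendedGraph q ⟨ tuple xs , fun shiftedᵗ (s ∷ xs) ⟩
    shifted∈ xs zero    = inj₁ (xs , refl)
    shifted∈ xs (suc s) with fun (stage c) (s ∷ xs) in e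
    ... | zero  = inj₁ (xs , refl)
    ... | suc y = inj₂ (xs , y , to (c⇔q xs y) (stage-sound c s xs e) , refl)

    -- Every `fst t` is the code of a tuple, so no input needs a default.
    enum∈ : ∀ t → ExtendedGraph q (fun enumᵗ [ t ])
    enum∈ t = subst (λ u → ExtendedGraph q ⟨ u , fun shiftedᵗ (snd t ∷ funs args [ t ]) ⟩)
                    (tuple-args t) (shifted∈ (funs args [ t ]) (snd t))

    enumerated : ∀ {z} → ExtendedGraph q z → Range (λ t → fun enumᵗ [ t ]) z
    enumerated (inj₁ (xs , refl)) = ⟨ tuple xs , 0 ⟩ , enum-⟨,⟩ xs 0
    enumerated (inj₂ (xs , y , xs↦y , refl)) with stage-complete c (from (c⇔q xs y) xs↦y)
    ... | s , e = ⟨ tuple xs , suc s ⟩ , trans (enum-⟨,⟩ xs (suc s)) (cong ⟨ tuple xs ,_⟩ (e s ≤-refl))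

  -- Recovering a function from an enumeration of its extended graph.

  module FromEnumeration (n : ℕ) (k : Total 2) where
    -- Variables t ∷ i ∷ x⃗.
    entryᵗ : Total (suc (suc (suc n)))
    entryᵗ = app k (varᵗ (# 1) ∷ᵗ varᵗ (# 0) ∷ᵗ []ᵗ)

    -- The entries `⟨ tuple xs , 0 ⟩` lie in every extended graph and carry no information, so they
    -- are rejected too.
    mismatchᵗ : Total (suc (suc (suc n)))
    mismatchᵗ = caseᵗ (diffᵗ (fstᵗ entryᵗ) (app (tupleᵗ n) (dropᵗ 2)))
                  (caseᵗ (sndᵗ entryᵗ) (sucᵗ zeroᵗ) zeroᵗ)
                  (sucᵗ zeroᵗ)

    mismatch≡0 : ∀ t i xs → fun mismatchᵗ (t ∷ i ∷ xs) ≡ 0 ⇔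
                 (∃[ y ] fun k (i ∷ t ∷ []) ≡ ⟨ tuple xs , suc y ⟩)
    mismatch≡0 t i xs = mk⇔ matching no-mismatch
      where
      z : ℕ
      z = fun k (i ∷ t ∷ [])

      diff : Total (suc (suc (suc n)))
      diff = diffᵗ (fstᵗ entryᵗ) (app (tupleᵗ n) (dropᵗ 2))

      diff≡0 : fun diff (t ∷ i ∷ xs) ≡ 0 ⇔ fst z ≡ fun (tupleᵗ n) xs
      diff≡0 = diffᵗ≡0 (fstᵗ entryᵗ) (app (tupleᵗ n) (dropᵗ 2)) (t ∷ i ∷ xs)

      matching : fun mismatchᵗ (t ∷ i ∷ xs) ≡ 0 → ∃[ y ] z ≡ ⟨ tuple xs , suc y ⟩
      matching e with fun diff (t ∷ i ∷ xs) in d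
      ... | zero with snd z in snd≡
      ...   | suc y = y , trans (sym (⟨fst,snd⟩ z))
                                (cong₂ ⟨_,_⟩ (trans (to diff≡0 d) (fun-tupleᵗ n xs)) snd≡)

      no-mismatch : ∃[ y ] z ≡ ⟨ tuple xs , suc y ⟩ → fun mismatchᵗ (t ∷ i ∷ xs) ≡ 0
      no-mismatch (y , e) with trans (cong unpair e) (unpair-⟨,⟩ (tuple xs) (suc y))
      ... | p rewrite from diff≡0 (trans (cong proj₁ p) (sym (fun-tupleᵗ n xs))) | cong proj₂ p = refl

    -- Undoes the shift by one in the extended graph; the search stops only where the second
    -- component is a successor.
    valueᵗ : Total (suc (suc (suc n)))
    valueᵗ = predᵗ (sndᵗ entryᵗ)

    fun-valueᵗ : ∀ t i xs y → fun k (i ∷ t ∷ []) ≡ ⟨ tuple xs , suc y ⟩ → fun valueᵗ (t ∷ i ∷ xs) ≡ y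
    fun-valueᵗ t i xs y e = trans (fun-predᵗ (sndᵗ entryᵗ) (t ∷ i ∷ xs))
      (cong pred (trans (cong snd e) (cong proj₂ (unpair-⟨,⟩ (tuple xs) (suc y)))))

    valueCode : Code (suc (suc n))
    valueCode = comp (code valueᵗ) (μ (code mismatchᵗ) ∷ codes (dropᵗ 0))

    decoded : PartFun (suc (suc n))
    decoded = record { Graph = valueCode [_]⇓_ ; singleValued = ⇓-functional valueCode }

    decoded∈𝒫 : decoded ∈ 𝒫 (suc (suc n))
    decoded∈𝒫 = valueCode , λ xs y → mk⇔ (λ p → p) (λ p → p)

    -- Whichever matching entry comes first, its value is the one that `r` takes at `xs`; a matching
    -- entry occurs if `r` is defined there.
    decoded≈ : ∀ i (r : PartFun (suc n)) → Range (λ t → fun k (i ∷ t ∷ [])) ≐ ExtendedGraph r →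
               fix-first decoded i ≈ r
    decoded≈ i r (range⊆ , ⊆range) xs y = mk⇔ sound complete
      where
      graph : ∀ {z y} → ExtendedGraph r z → z ≡ ⟨ tuple xs , suc y ⟩ → Graph r xs y
      graph (inj₁ (_ , refl)) e = ⊥-elim (0≢1+n (,-injectiveʳ (⟨,⟩-injective e)))
      graph (inj₂ (ys , w , ys↦w , refl)) e =
        subst₂ (Graph r) (tuple-injective (,-injectiveˡ (⟨,⟩-injective e)))
               (suc-injective (,-injectiveʳ (⟨,⟩-injective e))) ys↦w

      value∈ : ∀ t → fun mismatchᵗ (t ∷ i ∷ xs) ≡ 0 → Graph r xs (fun valueᵗ (t ∷ i ∷ xs))
      value∈ t e with to (mismatch≡0 t i xs) e
      ... | w , k≡ = subst (Graph r xs) (sym (fun-valueᵗ t i xs w k≡)) (graph (range⊆ (t , refl)) k≡)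

      sound : valueCode [ i ∷ xs ]⇓ y → Graph r xs y
      sound (comp⇓ {ys = t ∷ _} (p ∷ ps) q)
        with ⇓-functionals (codes (dropᵗ 0)) ps (corrects (dropᵗ 0) (i ∷ xs))
      ... | refl = subst (Graph r xs) (to (⇓⇔ valueᵗ (t ∷ i ∷ xs) y) q)
                         (value∈ t (proj₂ (to (μ⇓⇔ mismatchᵗ (i ∷ xs) t) p)))

      complete : Graph r xs y → valueCode [ i ∷ xs ]⇓ y
      complete xs↦y with ⊆range (inj₂ (xs , y , xs↦y , refl))
      ... | t , k≡ with least-zero (λ t → fun mismatchᵗ (t ∷ i ∷ xs)) t (from (mismatch≡0 t i xs) (y , k≡))
      ...   | t₀ , below , e = comp⇓
              (from (μ⇓⇔ mismatchᵗ (i ∷ xs) t₀) (below , e) ∷ corrects (dropᵗ 0) (i ∷ xs))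
              -- The search may stop at an entry other than the given one; `r` being single-valued,
              -- both carry `y`.
              (from (⇓⇔ valueᵗ (t₀ ∷ i ∷ xs) y) (singleValued r (value∈ t₀ e) xs↦y))

-- The two conditions for the standard numbering.

-- Membership is known for `r`, but `fixes` asks for it at the function in the numbering `φ` that
-- agrees with `r`.
𝓢-resp-≈ : {ℓ : Level} {A : Pred ℕ ℓ} {p q : PartFun n} → p ≈ q → p ∈ 𝓢 n A → q ∈ 𝓢 n A
𝓢-resp-≈ p≈q (inj₁ (f , f∈𝓡 , p≈f)) =
  inj₁ (f , f∈𝓡 , λ xs y → ⇔.trans (⇔.sym (p≈q xs y)) (p≈f xs y))
𝓢-resp-≈ p≈q (inj₂ (inj₁ empty)) = inj₂ (inj₁ λ xs (y , xs↦y) → empty xs (y , from (p≈q xs y) xs↦y))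
𝓢-resp-≈ p≈q (inj₂ (inj₂ (a , a∈A , dom⊆ , ⊆dom))) = inj₂ (inj₂ (a , a∈A ,
  (λ (y , xs↦y) → dom⊆ (y , from (p≈q _ y) xs↦y)) ,
  (λ xs<a → map₂ (λ {y} → to (p≈q _ y)) (⊆dom xs<a))))

theorem2p1 : ∀ {ℓ : Level} (π : Pairing) (m : ℕ) (A : Pred ℕ ℓ) (φ ψ : ℕ → PartFun (suc m)) →
    IsGödelNumbering φ →
    IsStandardNumbering φ (𝓢 (suc m) A) ψ →
    (∃[ f ] (f ∈ 𝓡 1 × Range (λ t → f [ t ]) ≐ Pairing.ExtendedGraph π (universal ψ)))
    ×
    (∀ k → k ∈ 𝓡 2 →
    ∃[ v ] (v ∈ 𝓡 1 ×
    (∀ i r → r ∈ 𝓢 (suc m) A →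
    Range (λ t → k (i ∷ t ∷ [])) ≐ Pairing.ExtendedGraph π r →
    r ≈ ψ (v [ i ]))))
theorem2p1 π m A φ ψ gödel standard = extendedGraph-enumerable (universal ψ) universalψ∈𝒫 , indices
  where
  open Tupling π
  open IsGödelNumbering gödel using (universalComputable; translation)
  open IsStandardNumbering standard using (d; d∈𝓡; factors; fixes)

  universalψ∈𝒫 : universal ψ ∈ 𝒫 (suc (suc m))
  universalψ∈𝒫 with universalComputable
  ... | u , u⇔φ = comp u (codes args) , λ { (i ∷ xs) y → 
      ⇔.trans (comp⇓⇔ u args (i ∷ xs) y)
              (⇔.trans (u⇔φ (d [ i ] ∷ xs) y) (⇔.sym (factors i xs y))) }
    where
    args : Totals (suc (suc m)) (suc (suc m))
    args = app (fromᴿ d∈𝓡) (varᵗ (# 0) ∷ᵗ []ᵗ) ∷ᵗ dropᵗ 1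

  indices : ∀ k → k ∈ 𝓡 2 → ∃[ v ] (v ∈ 𝓡 1 ×
            (∀ i r → r ∈ 𝓢 (suc m) A →
             Range (λ t → k (i ∷ t ∷ [])) ≐ Pairing.ExtendedGraph π r → r ≈ ψ (v [ i ])))
  indices k k∈𝓡 with translation decoded decoded∈𝒫
    where open FromEnumeration m (fromᴿ k∈𝓡)
  ... | s , s∈𝓡 , φs≈ = s , s∈𝓡 , index
    where
    open FromEnumeration m (fromᴿ k∈𝓡)

    index : ∀ i r → r ∈ 𝓢 (suc m) A →
            Range (λ t → k (i ∷ t ∷ [])) ≐ Pairing.ExtendedGraph π r → r ≈ ψ (s [ i ])
    index i r r∈𝓢 enumerates xs y =
      ⇔.trans (⇔.sym (φs≈r xs y)) (⇔.trans (⇔.sym (fixes (s [ i ]) φs∈𝓢 xs y)) (⇔.sym (factors (s [ i ]) xs y)))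
      where
      φs≈r : φ (s [ i ]) ≈ r
      φs≈r xs y = ⇔.trans (φs≈ i xs y) (decoded≈ i r enumerates xs y)

      φs∈𝓢 : φ (s [ i ]) ∈ 𝓢 (suc m) A
      φs∈𝓢 = 𝓢-resp-≈ {p = r} {q = φ (s [ i ])} (λ xs y → ⇔.sym (φs≈r xs y)) r∈𝓢
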